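{- (i) A finite connected graph is a partial cube if and only if it can be obtained from the one-vertex graph $K_1$ by a (finite, possibly empty) sequence of expansions. (ii) For a finite partial cube $G$, the number of expansions needed to produce $G$ from $K_1$ is $\dim_I(G)$.
   Context: Graphs are simple, undirected and nonempty. For a set $X$, the hypercube $\mathcal H(X)$ is the graph whose vertices are the finite subsets of $X$, with $P,Q$ adjacent iff $|P\Delta Q|=1$; its dimension is $|X|$. A graph is a partial cube if it can be isometrically embedded (i.e. by a map preserving shortest-path distances) into some $\mathcal H(X)$. The isometric dimension $\dim_I(G)$ of a partial cube $G$ is the minimum possible dimension of a hypercube into which $G$ is isometrically embeddable. A subgraph $H$ of a connected graph $G$ is isometric if $d_H(a,b)=d_G(a,b)$ for all vertices $a,b$ of $H$. Expansion: let $G=(V,E)$ be a connected graph and let $G_1=(V_1,E_1)$, $G_2=(V_2,E_2)$ be two nonempty isometric subgraphs of $G$ with $G=G_1\cup G_2$ (i.e. $V=V_1\cup V_2$, $E=E_1\cup E_2$). The expansion of $G$ with respect to $G_1$ and $G_2$ is the graph with vertex set $V'_1\cup V'_2$, where $V'_i=\{x^i=(i,x):x\in V_i\}$, whose edges are $x^iy^i$ for $xy\in E_i$ ($i=1,2$) together with the edges $x^1x^2$ for $x\in V_1\cap V_2$. Graphs are considered up to isomorphism. In (ii), the number of expansions needed is the minimum length of a sequence of expansions leading from $K_1$ to $G$. -}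

module Defs where

open import Data.Bool using (Bool; false; T; _xor_)
open import Data.Bool.Properties using (xor-same; xor-comm)
open import Data.Empty using (⊥)
open import Data.Fin using (Fin; zero)
open import Data.Nat using (ℕ; zero; suc; _≤_)
open import Data.Product using (Σ-syntax; ∃; ∃-syntax; _×_; _,_; proj₁; proj₂)
open import Data.Product.Function.Dependent.Propositional using (Σ-↔)
open import Data.Sum using (_⊎_; inj₁; inj₂)
open import Data.Sum.Relation.Binary.Pointwise using (_⊎ₛ_; inj₁; inj₂)
open import Data.Unit using (⊤; tt)
open import Function.Base using (id; _on_)
open import Function.Bundles using (Func; Inverse; _↔_; _↣_; _⇔_; mk↔ₛ′)
open import Function.Construct.Composition using (_↔-∘_)
open import Function.Construct.Identity using (↔-id)
open import Level using (0ℓ)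
open import Relation.Binary.Bundles using (Setoid)
open import Relation.Binary.Core using (Rel)
open import Relation.Binary.Definitions using (Symmetric; _Respects_; _Respects₂_)
import Relation.Binary.Construct.On as On
open import Relation.Binary.PropositionalEquality
  using (_≡_; refl; sym; trans; cong; subst; setoid; _→-setoid_)
open import Relation.Nullary using (¬_)
open import Relation.Unary using (Pred; _∈_)

------------------------------------------------------------------------
-- Graphs

-- Vertices form a setoid because the vertices of a hypercube are subsets,
-- whose equality is extensional.

record Graph : Set₁ where
  field
    V        : Setoid 0ℓ 0ℓ
  open Setoid V public using (_≈_) renaming (Carrier to Vertex)
  field
    _∼_      : Rel Vertex 0ℓ
    ∼-resp-≈ : _∼_ Respects₂ _≈_
    ∼-sym    : Symmetric _∼_
    ∼-irrefl : ∀ {x y} → x ≈ y → ¬ (x ∼ y)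
    nonempty : Vertex

open Graph using (V; Vertex)

Finite : Graph → Set
Finite G = ∃[ n ] Inverse (V G) (setoid (Fin n))

record _≅_ (G H : Graph) : Set where
  private
    module G = Graph G
    module H = Graph H
  field
    vertices : Inverse (V G) (V H)
    edges    : ∀ x y → (x G.∼ y) ⇔ (Inverse.to vertices x H.∼ Inverse.to vertices y)

K₁ : Graph
K₁ = record
  { V        = setoid ⊤
  ; _∼_      = λ _ _ → ⊥
  ; ∼-resp-≈ = (λ _ → id) , (λ _ → id)
  ; ∼-sym    = id
  ; ∼-irrefl = λ _ → id
  ; nonempty = tt
  }

------------------------------------------------------------------------
-- Distance

module _ (G : Graph) where
  open Graph G using (_≈_; _∼_)

  data Walk : ℕ → Vertex G → Vertex G → Set where
    nil  : ∀ {x y} → x ≈ y → Walk zero x y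
    cons : ∀ {k x y z} → x ∼ y → Walk k y z → Walk (suc k) x z

  Connected : Set
  Connected = ∀ x y → ∃[ k ] Walk k x y

  -- Distance x y k says d(x,y) = k; it holds for no k when d(x,y) = ∞.

  Distance : Vertex G → Vertex G → ℕ → Set
  Distance x y k = Walk k x y × (∀ m → Walk m x y → k ≤ m)

PreservesDistance : (G H : Graph) → (Vertex G → Vertex H) → Set
PreservesDistance G H f = ∀ x y k → Distance G x y k ⇔ Distance H (f x) (f y) k

IsometricEmbedding : Graph → Graph → Set
IsometricEmbedding G H = Σ[ f ∈ Func (V G) (V H) ] PreservesDistance G H (Func.to f)

------------------------------------------------------------------------
-- Hypercubes

-- A subset is given by its characteristic function, so that X itself need
-- not have decidable equality.

HasSize : {X : Set} → (X → Bool) → ℕ → Set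
HasSize S k = Fin k ↔ ∃ λ x → T (S x)

record FiniteSubset (X : Set) : Set where
  field
    member : X → Bool
    finite : ∃[ k ] HasSize member k

open FiniteSubset using (member)

_Δ_ : {X : Set} → FiniteSubset X → FiniteSubset X → X → Bool
(P Δ Q) x = member P x xor member Q x

∅ : {X : Set} → FiniteSubset X
∅ = record
  { member = λ _ → false
  ; finite = 0 , mk↔ₛ′ (λ ()) (λ { (_ , ()) }) (λ { (_ , ()) }) (λ ())
  }

HasSize-resp : {X : Set} {S S′ : X → Bool} {k : ℕ} →
               (∀ x → S x ≡ S′ x) → HasSize S k → HasSize S′ k
HasSize-resp {S = S} {S′} S≗S′ size = Σ-↔ (↔-id _) (T-cong (S≗S′ _)) ↔-∘ size
  where
  T-cong : ∀ {a b} → a ≡ b → T a ↔ T b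
  T-cong refl = ↔-id _

ℋ : Set → Graph
ℋ X = record
  { V        = record
      { Carrier       = FiniteSubset X
      ; _≈_           = λ P Q → ∀ x → member P x ≡ member Q x
      ; isEquivalence = On.isEquivalence member (Setoid.isEquivalence (X →-setoid Bool))
      }
  ; _∼_      = λ P Q → HasSize (P Δ Q) 1
  ; ∼-resp-≈ = (λ {P} Q≈R → HasSize-resp (λ x → cong (member P x xor_) (Q≈R x)))
             , (λ {P} Q≈R → HasSize-resp (λ x → cong (_xor member P x) (Q≈R x)))
  ; ∼-sym    = λ {P} {Q} → HasSize-resp (λ x → xor-comm (member P x) (member Q x))
  ; ∼-irrefl = λ {P} {Q} → irrefl P Q
  ; nonempty = ∅
  }
  where
  irrefl : ∀ P Q → (∀ x → member P x ≡ member Q x) → ¬ HasSize (P Δ Q) 1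
  irrefl P Q P≈Q size =
    let x , x∈PΔQ = Inverse.to {From = setoid _} {To = setoid (∃ λ x → T ((P Δ Q) x))} size zero
    in subst T (trans (cong (_xor member Q x) (P≈Q x)) (xor-same (member Q x))) x∈PΔQ

PartialCube : Graph → Set₁
PartialCube G = Σ[ X ∈ Set ] IsometricEmbedding G (ℋ X)

-- dim_I(G) = d.  Minimality is a comparison of the cardinals d and |X|, with X
-- possibly infinite.

IsometricDimension : Graph → ℕ → Set₁
IsometricDimension G d =
  IsometricEmbedding G (ℋ (Fin d)) ×
  (∀ (X : Set) → IsometricEmbedding G (ℋ X) → Fin d ↣ X)

------------------------------------------------------------------------
-- Expansions

record Subgraph (G : Graph) : Set₁ where
  open Graph G using (_≈_; _∼_)
  field
    Vₛ        : Pred (Vertex G) 0ℓ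
    Eₛ        : Rel (Vertex G) 0ℓ
    Vₛ-resp   : Vₛ Respects _≈_
    Eₛ-resp   : Eₛ Respects₂ _≈_
    Eₛ-sym    : Symmetric Eₛ
    Eₛ⊆Vₛ     : ∀ {x y} → Eₛ x y → x ∈ Vₛ × y ∈ Vₛ
    Eₛ⊆∼      : ∀ {x y} → Eₛ x y → x ∼ y
    nonemptyₛ : ∃ Vₛ

  graph : Graph
  graph = record
    { V        = On.setoid {B = ∃ Vₛ} (V G) proj₁
    ; _∼_      = Eₛ on proj₁
    ; ∼-resp-≈ = (λ y≈z → proj₁ Eₛ-resp y≈z) , (λ y≈z → proj₂ Eₛ-resp y≈z)
    ; ∼-sym    = Eₛ-sym
    ; ∼-irrefl = λ x≈y xy → Graph.∼-irrefl G x≈y (Eₛ⊆∼ xy)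
    ; nonempty = nonemptyₛ
    }

open Subgraph using (Vₛ; Eₛ; graph)

Isometric : {G : Graph} → Subgraph G → Set
Isometric {G} H = PreservesDistance (graph H) G proj₁

_≡_∪_ : (G : Graph) → Subgraph G → Subgraph G → Set
G ≡ G₁ ∪ G₂ =
  (∀ x → x ∈ Vₛ G₁ ⊎ x ∈ Vₛ G₂) ×
  (∀ x y → Graph._∼_ G x y → Eₛ G₁ x y ⊎ Eₛ G₂ x y)

expansion : {G : Graph} → Subgraph G → Subgraph G → Graph
expansion {G} G₁ G₂ = record
  { V        = V (graph G₁) ⊎ₛ V (graph G₂)
  ; _∼_      = _∼′_
  ; ∼-resp-≈ = (λ {u} {v} {w} → respʳ {u} {v} {w}) , (λ {u} {v} {w} → respˡ {u} {v} {w})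
  ; ∼-sym    = λ {u} {v} → ∼′-sym {u} {v}
  ; ∼-irrefl = irrefl
  ; nonempty = inj₁ (Graph.nonempty (graph G₁))
  }
  where
  module G  = Setoid (V G)
  module G₁ = Graph (graph G₁)
  module G₂ = Graph (graph G₂)
  V′ = V (graph G₁) ⊎ₛ V (graph G₂)
  open Setoid V′ using () renaming (Carrier to Vertex′; _≈_ to _≈′_; sym to ≈′-sym)

  -- In the mixed clauses both sides are copies of one vertex of G, which
  -- therefore lies in V₁ ∩ V₂.

  _∼′_ : Rel Vertex′ 0ℓ
  inj₁ u ∼′ inj₁ v = u G₁.∼ v
  inj₂ u ∼′ inj₂ v = u G₂.∼ v
  inj₁ u ∼′ inj₂ v = proj₁ u G.≈ proj₁ v
  inj₂ u ∼′ inj₁ v = proj₁ u G.≈ proj₁ v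

  ∼′-sym : Symmetric _∼′_
  ∼′-sym {inj₁ u} {inj₁ v} = G₁.∼-sym {u} {v}
  ∼′-sym {inj₂ u} {inj₂ v} = G₂.∼-sym {u} {v}
  ∼′-sym {inj₁ _} {inj₂ _} = G.sym
  ∼′-sym {inj₂ _} {inj₁ _} = G.sym

  respʳ : ∀ {u v w} → v ≈′ w → u ∼′ v → u ∼′ w
  respʳ {inj₁ u} (inj₁ v≈w) uv = proj₁ (Subgraph.Eₛ-resp G₁) v≈w uv
  respʳ {inj₁ _} (inj₂ v≈w) uv = G.trans uv v≈w
  respʳ {inj₂ _} (inj₁ v≈w) uv = G.trans uv v≈w
  respʳ {inj₂ u} (inj₂ v≈w) uv = proj₁ (Subgraph.Eₛ-resp G₂) v≈w uv

  respˡ : ∀ {u v w} → v ≈′ w → v ∼′ u → w ∼′ u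
  respˡ {u} {v} {w} v≈w vu = ∼′-sym {u} {w} (respʳ {u} v≈w (∼′-sym {v} {u} vu))

  irrefl : ∀ {u v} → u ≈′ v → ¬ (u ∼′ v)
  irrefl (inj₁ {u} {v} u≈v) = G₁.∼-irrefl {u} {v} u≈v
  irrefl (inj₂ {u} {v} u≈v) = G₂.∼-irrefl {u} {v} u≈v

record _IsExpansionOf_ (G′ G : Graph) : Set₁ where
  field
    connected  : Connected G
    G₁ G₂      : Subgraph G
    isometric₁ : Isometric G₁
    isometric₂ : Isometric G₂
    union      : G ≡ G₁ ∪ G₂
    result     : expansion G₁ G₂ ≅ G′

data ExpansionSequence (G : Graph) : ℕ → Graph → Set₁ where
  done   : ∀ {H} → G ≅ H → ExpansionSequence G zero H
  expand : ∀ {n H H′} → ExpansionSequence G n H → H′ IsExpansionOf H →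
           ExpansionSequence G (suc n) H′

-- The least length of a sequence of expansions from K₁ to G is d.

ExpansionNumber : Graph → ℕ → Set₁
ExpansionNumber G d =
  ExpansionSequence K₁ d G × (∀ m → ExpansionSequence K₁ m G → d ≤ m)

{-# OPTIONS --safe #-}

-- An isometric embedding of G into the cube of dimension m labels the vertices
-- by bit vectors so that distance is Hamming distance.  An expansion of a
-- labelled graph is labelled by one more bit, which tells the two copies apart.
-- Conversely, if bit zero takes both values, then identifying the vertices that
-- agree in the remaining bits yields a labelled graph of which G is an
-- expansion, along the classes that have a representative with bit zero off,
-- respectively on.  Once the constant bits of an embedding of a finite G are
-- dropped, the number d of bits is therefore a length of a sequence of
-- expansions.  It is the least one, and the least dimension, because every
-- remaining bit is flipped by some edge, and mapping it to the bit which that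
-- edge flips in another labelling is injective: the edge determines the
-- halfspaces of the bit in terms of distances alone.

module Submission where

open import Defs
open import Algebra.Properties.CommutativeSemigroup using (interchange)
open import Data.Bool using (Bool; true; false; not; if_then_else_; T; T?; _∧_; _∨_; _xor_)
open import Data.Bool.Properties as Bool
  using (T-irrelevant; T-∨; xor-same; xor-comm; xor-assoc; ¬-not; not-¬)
open import Data.Fin using (Fin; zero; suc; punchIn; punchOut)
open import Data.Fin.Permutation using (↔⇒≡)
open import Data.Fin.Properties as Fin
  using (punchIn-punchOut; +↔⊎; injective⇒≤; any?; all?; ¬∀⟶∃¬)
open import Data.Nat using (ℕ; zero; suc; _+_; _≤_; z≤n; s≤s; s≤s⁻¹)
open import Data.Nat.Properties
open import Data.Product using (Σ; ∃; ∃-syntax; _×_; _,_; proj₁; proj₂)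
open import Data.Product.Function.Dependent.Propositional using (Σ-↔)
open import Data.Sum using (_⊎_; inj₁; inj₂; [_,_]′)
open import Data.Sum.Function.Propositional using (_⊎-↔_)
open import Data.Sum.Relation.Binary.Pointwise using (inj₁; inj₂)
open import Data.Unit using (tt)
open import Data.Vec.Functional using (Vector; _∷_; removeAt)
open import Function.Base using (_∘_; id)
open import Function.Bundles
  using (Func; Inverse; Injection; Equivalence; _↔_; _↣_; _⇔_; mk↔ₛ′; mk↣; mk⇔)
open import Function.Construct.Composition using (_↔-∘_; _↣-∘_)
open import Function.Construct.Identity using (↔-id)
open import Function.Construct.Symmetry using (↔-sym)
open import Function.Properties.Inverse using (↔⇒↣)
open import Function.Related.TypeIsomorphisms using (Σ-distribˡ-⊎)
open import Relation.Binary.Bundles using (Setoid)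
import Relation.Binary.Construct.On as On
open import Relation.Binary.PropositionalEquality
  using (_≡_; _≢_; _≗_; refl; sym; trans; cong; cong₂; subst; _→-setoid_; module ≡-Reasoning)
open import Relation.Nullary using (¬_; Dec; yes; no; does; contradiction)
open import Relation.Nullary.Decidable using (decidable-stable; ¬?)

open import Algebra.Properties.CommutativeMonoid.Sum +-0-commutativeMonoid
  using (sum; sum-remove; sum-cong-≗)

open Graph using (V; Vertex)
open FiniteSubset using (member; finite)
open Inverse using () renaming (to to _⟨$⟩_; from to _⟨$⟩⁻¹_)

private
  variable
    k l m n : ℕ
    X : Set
    G H : Graph

-- Hamming distance

bit : Bool → ℕ
bit b = if b then 1 else 0

count : Vector Bool m → ℕ
count S = sum (bit ∘ S)

ham : Vector Bool m → Vector Bool m → ℕ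
ham P Q = count λ i → P i xor Q i

bit-≡ : ∀ {a b} → a ≡ b → bit (a xor b) ≡ 0
bit-≡ {a} refl = cong bit (xor-same a)

bit-≢ : ∀ {a b} → a ≢ b → bit (a xor b) ≡ 1
bit-≢ {true}  {true}  a≢b = contradiction refl a≢b
bit-≢ {true}  {false} a≢b = refl
bit-≢ {false} {true}  a≢b = refl
bit-≢ {false} {false} a≢b = contradiction refl a≢b

bit-triangle : ∀ a b c → bit (a xor c) ≤ bit (a xor b) + bit (b xor c)
bit-triangle true  true  c     = ≤-refl
bit-triangle true  false true  = z≤n
bit-triangle true  false false = ≤-refl
bit-triangle false true  true  = ≤-refl
bit-triangle false true  false = z≤n
bit-triangle false false c     = ≤-refl

ham-cong : ∀ {P P′ Q Q′ : Vector Bool m} → P ≗ P′ → Q ≗ Q′ → ham P Q ≡ ham P′ Q′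
ham-cong P≗P′ Q≗Q′ = sum-cong-≗ λ i → cong₂ (λ a b → bit (a xor b)) (P≗P′ i) (Q≗Q′ i)

ham-sym : ∀ (P Q : Vector Bool m) → ham P Q ≡ ham Q P
ham-sym P Q = sum-cong-≗ λ i → cong bit (xor-comm (P i) (Q i))

ham-remove : ∀ i (P Q : Vector Bool (suc m)) →
             ham P Q ≡ bit (P i xor Q i) + ham (removeAt P i) (removeAt Q i)
ham-remove i P Q = sum-remove {i = i} λ i → bit (P i xor Q i)

≗⇒ham≡0 : ∀ {P Q : Vector Bool m} → P ≗ Q → ham P Q ≡ 0
≗⇒ham≡0 {zero}  P≗Q = refl
≗⇒ham≡0 {suc m} P≗Q = cong₂ _+_ (bit-≡ (P≗Q zero)) (≗⇒ham≡0 (P≗Q ∘ suc))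

ham≡0⇒≗ : ∀ (P Q : Vector Bool m) → ham P Q ≡ 0 → P ≗ Q
ham≡0⇒≗ {suc m} P Q h≡0 i with P i Bool.≟ Q i
... | yes Pi≡Qi = Pi≡Qi
... | no  Pi≢Qi = contradiction
  (trans (sym h≡0) (trans (ham-remove i P Q) (cong₂ _+_ (bit-≢ Pi≢Qi) refl))) λ ()

ham-differ : ∀ (P Q : Vector Bool m) → ham P Q ≡ suc k → ∃[ i ] P i ≢ Q i
ham-differ {suc m} P Q h≡1+k with P zero Bool.≟ Q zero
... | no  P0≢Q0 = zero , P0≢Q0
... | yes P0≡Q0 =
  let i , Pi≢Qi = ham-differ (P ∘ suc) (Q ∘ suc) (trans (sym (cong₂ _+_ (bit-≡ P0≡Q0) refl)) h≡1+k)
  in suc i , Pi≢Qi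

ham-triangle : ∀ (P Q R : Vector Bool m) → ham P R ≤ ham P Q + ham Q R
ham-triangle {zero}  P Q R = z≤n
ham-triangle {suc m} P Q R = ≤-trans
  (+-mono-≤ (bit-triangle (P zero) (Q zero) (R zero)) (ham-triangle (P ∘ suc) (Q ∘ suc) (R ∘ suc)))
  (≤-reflexive (interchange +-commutativeSemigroup (bit (P zero xor Q zero)) _ _ _))

ham≡1⇒remove-≗ : ∀ (P Q : Vector Bool (suc m)) {i} → ham P Q ≡ 1 → P i ≢ Q i →
                 removeAt P i ≗ removeAt Q i
ham≡1⇒remove-≗ P Q {i} h≡1 Pi≢Qi = ham≡0⇒≗ (removeAt P i) (removeAt Q i) (suc-injective (begin
  1 + ham (removeAt P i) (removeAt Q i)                  ≡⟨ cong₂ _+_ (bit-≢ Pi≢Qi) refl ⟨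
  bit (P i xor Q i) + ham (removeAt P i) (removeAt Q i)  ≡⟨ ham-remove i P Q ⟨
  ham P Q                                                ≡⟨ h≡1 ⟩
  1                                                      ∎))
  where open ≡-Reasoning

ham≡1⇒unique : ∀ (P Q : Vector Bool m) {i j} → ham P Q ≡ 1 → P i ≢ Q i → P j ≢ Q j → i ≡ j
ham≡1⇒unique {suc m} P Q {i} {j} h≡1 Pi≢Qi Pj≢Qj with i Fin.≟ j
... | yes i≡j = i≡j
... | no  i≢j = contradiction
  (subst (λ l → P l ≡ Q l) (punchIn-punchOut i≢j) (ham≡1⇒remove-≗ P Q h≡1 Pi≢Qi (punchOut i≢j))) Pj≢Qj

-- `C` and `D` agree outside `i`, so only bit `i` can tell their distances to `P` apart. This
-- decides which end of an edge is nearer.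
ham-step : ∀ (P C D : Vector Bool m) {i} → ham C D ≡ 1 → C i ≢ D i → P i ≡ C i →
           ham P D ≡ suc (ham P C)
ham-step {suc m} P C D {i} h≡1 Ci≢Di Pi≡Ci = begin
  ham P D
    ≡⟨ ham-remove i P D ⟩
  bit (P i xor D i) + ham (removeAt P i) (removeAt D i)
    ≡⟨ cong₂ _+_ (bit-≢ λ Pi≡Di → Ci≢Di (trans (sym Pi≡Ci) Pi≡Di))
         (ham-cong {P = removeAt P i} {Q = removeAt D i} {removeAt C i}
           (λ _ → refl) (sym ∘ ham≡1⇒remove-≗ C D h≡1 Ci≢Di)) ⟩
  1 + ham (removeAt P i) (removeAt C i)
    ≡⟨ cong suc (cong₂ _+_ (bit-≡ Pi≡Ci) refl) ⟨
  suc (bit (P i xor C i) + ham (removeAt P i) (removeAt C i))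
    ≡⟨ cong suc (ham-remove i P C) ⟨
  suc (ham P C)
    ∎
  where open ≡-Reasoning

-- Walks and distances

module _ (G : Graph) where
  open Graph G using (_≈_; _∼_; ∼-resp-≈; ∼-sym; ∼-irrefl)
  private module V = Setoid (Graph.V G)

  walk-respˡ : ∀ {x x′ y} → x ≈ x′ → Walk G k x′ y → Walk G k x y
  walk-respˡ x≈x′ (nil x′≈y)     = nil (V.trans x≈x′ x′≈y)
  walk-respˡ x≈x′ (cons x′∼z w) = cons (proj₂ ∼-resp-≈ (V.sym x≈x′) x′∼z) w

  walk-respʳ : ∀ {x y y′} → y ≈ y′ → Walk G k x y → Walk G k x y′
  walk-respʳ y≈y′ (nil x≈y)    = nil (V.trans x≈y y≈y′)
  walk-respʳ y≈y′ (cons x∼z w) = cons x∼z (walk-respʳ y≈y′ w)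

  snoc : ∀ {x y z} → Walk G k x y → y ∼ z → Walk G (suc k) x z
  snoc (nil x≈y)    y∼z = cons (proj₂ ∼-resp-≈ (V.sym x≈y) y∼z) (nil V.refl)
  snoc (cons x∼u w) y∼z = cons x∼u (snoc w y∼z)

  walk-sym : ∀ {x y} → Walk G k x y → Walk G k y x
  walk-sym (nil x≈y)    = nil (V.sym x≈y)
  walk-sym (cons x∼z w) = snoc (walk-sym w) (∼-sym x∼z)

  distance-unique : ∀ {x y} → Distance G x y k → Distance G x y l → k ≡ l
  distance-unique (w , min) (w′ , min′) = ≤-antisym (min _ w′) (min′ _ w)

-- The triangle inequality along the walk. Asking for at most one across an edge makes the bound
-- apply also to walks in `ℋ X` that leave a given finite set.
ham≤length : (φ : Vertex G → Vector Bool m) →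
             (∀ {x y} → Graph._≈_ G x y → φ x ≗ φ y) →
             (∀ {x y} → Graph._∼_ G x y → ham (φ x) (φ y) ≤ 1) →
             ∀ {x y} → Walk G k x y → ham (φ x) (φ y) ≤ k
ham≤length φ φ-cong edge (nil x≈y) = ≤-reflexive (≗⇒ham≡0 (φ-cong x≈y))
ham≤length φ φ-cong edge {x} {y} (cons {y = z} x∼z w) =
  ≤-trans (ham-triangle (φ x) (φ z) (φ y)) (+-mono-≤ (edge x∼z) (ham≤length φ φ-cong edge w))

-- The labels are the characteristic functions of the subsets assigned to the
-- vertices by an isometric embedding into ℋ (Fin m).

record Labelling (G : Graph) (m : ℕ) : Set where
  field
    label      : Vertex G → Vector Bool m
    label-cong : ∀ {x y} → Graph._≈_ G x y → label x ≗ label y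
    distance   : ∀ x y → Distance G x y (ham (label x) (label y))

  open Graph G using (_≈_; _∼_; ∼-resp-≈; ∼-sym; ∼-irrefl)
  private module V = Setoid (Graph.V G)

  h : Vertex G → Vertex G → ℕ
  h x y = ham (label x) (label y)

  h≤ : ∀ {x y} → Walk G k x y → h x y ≤ k
  h≤ = proj₂ (distance _ _) _

  h≡0⇒≈ : ∀ {x y} → h x y ≡ 0 → x ≈ y
  h≡0⇒≈ {x} {y} h≡0 with nil x≈y ← subst (λ k → Walk G k x y) h≡0 (proj₁ (distance x y)) = x≈y

  h≡1⇒∼ : ∀ {x y} → h x y ≡ 1 → x ∼ y
  h≡1⇒∼ {x} {y} h≡1
    with cons x∼z (nil z≈y) ← subst (λ k → Walk G k x y) h≡1 (proj₁ (distance x y)) =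
    proj₁ ∼-resp-≈ z≈y x∼z

  ∼⇒h≡1 : ∀ {x y} → x ∼ y → h x y ≡ 1
  ∼⇒h≡1 {x} {y} x∼y with h x y in eq | h≤ (cons x∼y (nil V.refl))
  ... | zero  | _         = contradiction x∼y (∼-irrefl (h≡0⇒≈ eq))
  ... | suc _ | s≤s z≤n = refl

  connected : Connected G
  connected x y = h x y , proj₁ (distance x y)

  -- One edge lowers the Hamming distance to `y` by at most one, so the tail of a geodesic is again
  -- a geodesic; the inductions along geodesics rest on this.
  geodesic-tail : ∀ {x y z} → x ∼ z → Walk G k z y → suc k ≡ h x y → k ≡ h z y
  geodesic-tail {k} {x} {y} {z} x∼z w 1+k≡h = ≤-antisym
    (s≤s⁻¹ (≤-trans (≤-reflexive 1+k≡h)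
      (≤-trans (ham-triangle (label x) (label z) (label y)) (≤-reflexive (cong (_+ h z y) (∼⇒h≡1 x∼z))))))
    (h≤ w)

open Labelling

-- Edges of Hamming length at most one make every walk long enough, so only a walk of the right
-- length has to be supplied.
mkLabelling : (φ : Vertex G → Vector Bool m) →
              (∀ {x y} → Graph._≈_ G x y → φ x ≗ φ y) →
              (∀ {x y} → Graph._∼_ G x y → ham (φ x) (φ y) ≤ 1) →
              (∀ x y → Walk G (ham (φ x) (φ y)) x y) →
              Labelling G m
mkLabelling φ φ-cong edge walk = record
  { label = φ ; label-cong = φ-cong ; distance = λ x y → walk x y , λ _ → ham≤length φ φ-cong edge }

-- Equal labels give equal Hamming distances, and a distance is unique where it exists.
preserves-distance : (L : Labelling G m) (L′ : Labelling H m) (f : Vertex G → Vertex H) →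
                     (∀ x → label L′ (f x) ≗ label L x) → PreservesDistance G H f
preserves-distance {G} {H = H} L L′ f same x y k = mk⇔
  (λ d → subst (Distance H (f x) (f y))
           (trans h≡h′ (distance-unique G (distance L x y) d)) (distance L′ (f x) (f y)))
  (λ d → subst (Distance G x y)
           (trans (sym h≡h′) (distance-unique H (distance L′ (f x) (f y)) d)) (distance L x y))
  where
  h≡h′ : h L′ (f x) (f y) ≡ h L x y
  h≡h′ = ham-cong (same x) (same y)

-- Distance in hypercubes

count-size : (S : Vector Bool m) → HasSize S (count S)
count-size {zero}  S = mk↔ₛ′ (λ ()) (λ ()) (λ ()) (λ ())
count-size {suc m} S =
  mk↔ₛ′ split merge (λ { (zero , _) → refl ; (suc _ , _) → refl }) (λ { (inj₁ _) → refl ; (inj₂ _) → refl })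
  ↔-∘ ((bit-size (S zero) ⊎-↔ count-size (S ∘ suc)) ↔-∘ +↔⊎)
  where
  bit-size : ∀ b → Fin (bit b) ↔ T b
  bit-size true  = mk↔ₛ′ (λ _ → tt) (λ _ → zero) (λ _ → refl) (λ { zero → refl })
  bit-size false = mk↔ₛ′ (λ ()) (λ ()) (λ ()) (λ ())
  split : T (S zero) ⊎ (∃ λ i → T (S (suc i))) → ∃ λ i → T (S i)
  split (inj₁ s)       = zero , s
  split (inj₂ (i , s)) = suc i , s
  merge : (∃ λ i → T (S i)) → T (S zero) ⊎ (∃ λ i → T (S (suc i)))
  merge (zero  , s) = inj₁ s
  merge (suc i , s) = inj₂ (i , s)

Subset-≡ : {S : X → Bool} {p q : ∃ λ x → T (S x)} → proj₁ p ≡ proj₁ q → p ≡ q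
Subset-≡ refl = cong (_ ,_) (T-irrelevant _ _)

size-unique : {S : X → Bool} → HasSize S k → HasSize S l → k ≡ l
size-unique size size′ = ↔⇒≡ (↔-sym size′ ↔-∘ size)

-- Subsets of a finite set as bit vectors

infix 4 _⊆_

_⊆_ : (X → Bool) → (X → Bool) → Set
S ⊆ U = ∀ x → T (S x) → T (U x)

-- `X` may be infinite and without decidable equality, but an enumeration of `U` turns the subsets
-- of `U` into bit vectors.
module Restriction {U : X → Bool} (U-size : HasSize U m) where

  ι : Fin m → X
  ι i = proj₁ (U-size ⟨$⟩ i)

  ι-injective : ∀ {i j} → ι i ≡ ι j → i ≡ j
  ι-injective ιi≡ιj = Injection.injective (↔⇒↣ U-size) (Subset-≡ ιi≡ιj)

  index : ∀ x → T (U x) → Fin m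
  index x x∈U = U-size ⟨$⟩⁻¹ (x , x∈U)

  ι-index : ∀ x x∈U → ι (index x x∈U) ≡ x
  ι-index x x∈U = cong proj₁ (Inverse.strictlyInverseˡ U-size (x , x∈U))

  index-ι : ∀ i x∈U → index (ι i) x∈U ≡ i
  index-ι i x∈U = ι-injective (ι-index (ι i) x∈U)

  agree : {S S′ : X → Bool} → S ⊆ U → S′ ⊆ U → S ∘ ι ≗ S′ ∘ ι → S ≗ S′
  agree {S} {S′} S⊆U S′⊆U same x with T? (U x)
  ... | yes x∈U = subst (λ x → S x ≡ S′ x) (ι-index x x∈U) (same (index x x∈U))
  ... | no  x∉U = trans (¬T⇒≡false (x∉U ∘ S⊆U x)) (sym (¬T⇒≡false (x∉U ∘ S′⊆U x)))
    where
    ¬T⇒≡false : ∀ {b} → ¬ T b → b ≡ false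
    ¬T⇒≡false {true}  ¬t = contradiction tt ¬t
    ¬T⇒≡false {false} ¬t = refl

  restrict-size : {S : X → Bool} → S ⊆ U → HasSize S (count (S ∘ ι))
  restrict-size {S} S⊆U = mk↔ₛ′
    (λ (i , s) → ι i , s)
    (λ (x , s) → index x (S⊆U x s) , subst (T ∘ S) (sym (ι-index x (S⊆U x s))) s)
    (λ (x , s) → Subset-≡ (ι-index x (S⊆U x s)))
    (λ (i , s) → Subset-≡ (index-ι i (S⊆U (ι i) s)))
    ↔-∘ count-size (S ∘ ι)

  -- `S` may stick out of `U`, hence an inequality. It bounds the steps of walks that leave `U`.
  restrict-≤ : {S : X → Bool} → HasSize S k → count (S ∘ ι) ≤ k
  restrict-≤ {S = S} size = injective⇒≤ (Injection.injective
    (↔⇒↣ (↔-sym size) ↣-∘ (mk↣ {to = include} include-injective ↣-∘ ↔⇒↣ (count-size (S ∘ ι)))))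
    where
    include : (∃ λ i → T (S (ι i))) → ∃ λ x → T (S x)
    include (i , s) = ι i , s
    include-injective : ∀ {p q} → include p ≡ include q → p ≡ q
    include-injective p≡q = Subset-≡ (ι-injective (cong proj₁ p≡q))

  module _ (i : Fin m) where

    -- Membership compares indices in `U`, since equality on `X` itself need not be decidable.
    singleton : X → Bool
    singleton x with T? (U x)
    ... | yes x∈U = does (index x x∈U Fin.≟ i)
    ... | no  _   = false

    singleton-self : T (singleton (ι i))
    singleton-self with T? (U (ι i))
    ... | no  ιi∉U = ιi∉U (proj₂ (U-size ⟨$⟩ i))
    ... | yes ιi∈U with index (ι i) ιi∈U Fin.≟ i
    ...   | yes _ = tt
    ...   | no ≢i = ≢i (index-ι i ιi∈U)

    singleton-unique : ∀ x → T (singleton x) → ι i ≡ x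
    singleton-unique x s with T? (U x)
    ... | yes x∈U with yes refl ← index x x∈U Fin.≟ i = ι-index x x∈U

    singleton⊆U : singleton ⊆ U
    singleton⊆U x s with T? (U x)
    ... | yes x∈U = x∈U

    singleton-size : HasSize singleton 1
    singleton-size = mk↔ₛ′ (λ _ → ι i , singleton-self) (λ _ → zero)
      (λ (x , s) → Subset-≡ (singleton-unique x s)) (λ { zero → refl })

  xor⊆U : {S S′ : X → Bool} → S ⊆ U → S′ ⊆ U → (λ x → S x xor S′ x) ⊆ U
  xor⊆U {S} {S′} S⊆U S′⊆U x s = [ S⊆U x , S′⊆U x ]′ (xor-⊎ (S x) s)
    where
    xor-⊎ : ∀ a {b} → T (a xor b) → T a ⊎ T b
    xor-⊎ true  _ = inj₁ tt
    xor-⊎ false t = inj₂ t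

  h′ : FiniteSubset X → FiniteSubset X → ℕ
  h′ P Q = ham (member P ∘ ι) (member Q ∘ ι)

  -- Flipping one differing element after another stays inside `U` and lowers the Hamming distance
  -- by one each time.
  cube-walk : ∀ P Q → member P ⊆ U → member Q ⊆ U → h′ P Q ≡ k → Walk (ℋ X) k P Q
  cube-walk {zero}  P Q P⊆U Q⊆U h≡0 = nil (agree P⊆U Q⊆U (ham≡0⇒≗ _ _ h≡0))
  cube-walk {suc k} P Q P⊆U Q⊆U h≡1+k =
    cons P∼P′ (cube-walk P′ Q P′⊆U Q⊆U (suc-injective (begin
      suc (h′ P′ Q)  ≡⟨ cong suc (ham-sym (member P′ ∘ ι) (member Q ∘ ι)) ⟩
      -- The edge is taken from `P′` to `P` and observed from `Q`, which sides with `P′` in bit `i`.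
      suc (h′ Q P′)  ≡⟨ ham-step (member Q ∘ ι) (member P′ ∘ ι) (member P ∘ ι) h≡1 (P≢P′ ∘ sym) Q≡P′ ⟨
      h′ Q P         ≡⟨ ham-sym (member Q ∘ ι) (member P ∘ ι) ⟩
      h′ P Q         ≡⟨ h≡1+k ⟩
      suc k          ∎)))
    where
    open ≡-Reasoning
    i = proj₁ (ham-differ (member P ∘ ι) (member Q ∘ ι) h≡1+k)
    P≢Q : member P (ι i) ≢ member Q (ι i)
    P≢Q = proj₂ (ham-differ (member P ∘ ι) (member Q ∘ ι) h≡1+k)
    P′⊆U : (λ x → member P x xor singleton i x) ⊆ U
    P′⊆U = xor⊆U P⊆U (singleton⊆U i)
    P′ : FiniteSubset X
    P′ = record { finite = _ , restrict-size P′⊆U }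
    P∼P′ : Graph._∼_ (ℋ X) P P′
    P∼P′ = HasSize-resp (λ x → sym (xor-cancelˡ (member P x) _)) (singleton-size i)
      where
      xor-cancelˡ : ∀ a b → a xor (a xor b) ≡ b
      xor-cancelˡ a b = trans (sym (xor-assoc a a b)) (cong (_xor b) (xor-same a))
    h≡1 : h′ P′ P ≡ 1
    h≡1 = size-unique (restrict-size (xor⊆U P′⊆U P⊆U)) (Graph.∼-sym (ℋ X) {P} {P′} P∼P′)
    P≢P′ : member P (ι i) ≢ member P′ (ι i)
    P≢P′ = flipped (member P (ι i)) (singleton-self i)
      where
      flipped : ∀ a {b} → T b → a ≢ a xor b
      flipped true  {true} _ ()
      flipped false {true} _ ()
    Q≡P′ : member Q (ι i) ≡ member P′ (ι i)
    Q≡P′ = trans (¬-not (P≢Q ∘ sym)) (sym (¬-not (P≢P′ ∘ sym)))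

  cube-distance : ∀ P Q → member P ⊆ U → member Q ⊆ U → Distance (ℋ X) P Q (h′ P Q)
  cube-distance P Q P⊆U Q⊆U =
    cube-walk P Q P⊆U Q⊆U refl ,
    λ _ → ham≤length (λ R → member R ∘ ι) (λ R≈S → R≈S ∘ ι) restrict-≤

cube-labelling : Labelling (ℋ (Fin m)) m
cube-labelling = record
  { label      = member
  ; label-cong = id
  ; distance   = λ P Q → cube-distance P Q _ _
  }
  where
  open Restriction {U = λ _ → true}
    (mk↔ₛ′ (λ i → i , tt) proj₁ (λ _ → refl) (λ _ → refl))

-- Labellings and isometric embeddings

labelling⇒embedding : Labelling G m → IsometricEmbedding G (ℋ (Fin m))
labelling⇒embedding L =
  record { to = subset ; cong = label-cong L } ,
  preserves-distance L cube-labelling subset λ _ _ → refl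
  where
  subset = λ x → record { member = label L x ; finite = _ , count-size (label L x) }

infixr 6 _∪ᶠ_

_∪ᶠ_ : FiniteSubset X → FiniteSubset X → FiniteSubset X
P ∪ᶠ Q = record
  { member = λ x → member P x ∨ member Q x
  -- A size is a bijection, so the union is split disjointly into `P` and the part of `Q` outside
  -- `P`, which is counted inside `Q`.
  ; finite = _ , Σ-↔ (↔-id _) (↔-sym (∨-↔ _ _)) ↔-∘ (↔-sym Σ-distribˡ-⊎
                 ↔-∘ ((proj₂ (finite P) ⊎-↔ restrict-size λ x → ∧-T (member P x)) ↔-∘ +↔⊎))
  }
  where
  open Restriction (proj₂ (finite Q))
  ∨-↔ : ∀ a b → T (a ∨ b) ↔ (T a ⊎ T (not a ∧ b))
  ∨-↔ true  b = mk↔ₛ′ inj₁ (λ _ → tt) (λ { (inj₁ _) → refl }) (λ _ → refl)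
  ∨-↔ false b = mk↔ₛ′ inj₂ (λ { (inj₂ t) → t }) (λ { (inj₂ _) → refl }) (λ _ → refl)
  ∧-T : ∀ a {b} → T (not a ∧ b) → T b
  ∧-T false t = t

⋃ : (Fin n → FiniteSubset X) → FiniteSubset X
⋃ {zero}  P = ∅
⋃ {suc n} P = P zero ∪ᶠ ⋃ (P ∘ suc)

⊆⋃ : (P : Fin n → FiniteSubset X) → ∀ i → member (P i) ⊆ member (⋃ P)
⊆⋃ P zero    x p = Equivalence.from T-∨ (inj₁ p)
⊆⋃ P (suc i) x p = Equivalence.from (T-∨ {member (P zero) x}) (inj₂ (⊆⋃ (P ∘ suc) i x p))

-- The finitely many images lie in one finite set, their union, whose elements serve as coordinates.
-- The injection into `X` is kept for comparing dimensions.
embedding⇒labelling : Finite G → IsometricEmbedding G (ℋ X) → ∃[ m ] (Labelling G m × (Fin m ↣ X))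
embedding⇒labelling {G} (_ , vertices) (f , preserves) = _ ,
  record
    { label      = λ x → member (f₀ x) ∘ ι
    ; label-cong = λ x≈y → Func.cong f x≈y ∘ ι
    ; distance   = λ x y → Equivalence.from (preserves x y _) (cube-distance (f₀ x) (f₀ y) (f⊆U x) (f⊆U y))
    } ,
  mk↣ ι-injective
  where
  f₀ = Func.to f
  U = ⋃ λ j → f₀ (vertices ⟨$⟩⁻¹ j)
  open Restriction (proj₂ (finite U))
  f⊆U : ∀ x → member (f₀ x) ⊆ member U
  f⊆U x z p = ⊆⋃ (λ j → f₀ (vertices ⟨$⟩⁻¹ j)) (vertices ⟨$⟩ x) z
    (subst T (sym (Func.cong f (Inverse.strictlyInverseʳ vertices x) z)) p)

-- Coordinates that separate vertices

Tight : Labelling G m → Set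
Tight {m = m} L = ∀ (i : Fin m) → ∃[ x ] ∃[ y ] label L x i ≢ label L y i

-- A constant bit contributes nothing to any Hamming distance.
remove-coordinate : (L : Labelling G (suc m)) (i : Fin (suc m)) →
                    (∀ x y → label L x i ≡ label L y i) → Labelling G m
remove-coordinate {G} L i constant = record
  { label      = λ x → removeAt (label L x) i
  ; label-cong = λ x≈y → label-cong L x≈y ∘ punchIn i
  ; distance   = λ x y → subst (Distance G x y)
      (trans (ham-remove i (label L x) (label L y)) (cong₂ _+_ (bit-≡ (constant x y)) refl))
      (distance L x y)
  }

-- Finiteness of `G` makes it decidable whether a bit takes both values; constant bits are dropped
-- one by one until none is left.
tighten : Finite G → Labelling G m → ∃[ d ] Σ (Labelling G d) Tight
tighten {m = zero} _ L = zero , L , λ ()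
tighten {G} {suc m} G-finite@(n , vertices) L = decide (all? separated?)
  where
  v : Fin n → Vertex G
  v = vertices ⟨$⟩⁻¹_
  Separated : Fin (suc m) → Set
  Separated i = ∃[ j ] ∃[ k ] label L (v j) i ≢ label L (v k) i
  separated? : ∀ i → Dec (Separated i)
  separated? i = any? λ j → any? λ k → ¬? (label L (v j) i Bool.≟ label L (v k) i)
  constant : ∀ {i} → ¬ Separated i → ∀ x y → label L x i ≡ label L y i
  constant {i} ¬separated x y = begin
    label L x i                     ≡⟨ label-cong L (Inverse.strictlyInverseʳ vertices x) i ⟨
    label L (v (vertices ⟨$⟩ x)) i  ≡⟨ decidable-stable (_ Bool.≟ _) (λ ≢ → ¬separated (_ , _ , ≢)) ⟩
    label L (v (vertices ⟨$⟩ y)) i  ≡⟨ label-cong L (Inverse.strictlyInverseʳ vertices y) i ⟩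
    label L y i                     ∎
    where open ≡-Reasoning
  decide : Dec (∀ i → Separated i) → ∃[ d ] Σ (Labelling G d) Tight
  decide (yes separated) = suc m , L , λ i → let j , k , j≢k = separated i in v j , v k , j≢k
  decide (no ¬separated) =
    let i , ¬separatedᵢ = ¬∀⟶∃¬ _ Separated separated? ¬separated
    in tighten G-finite (remove-coordinate L i (constant ¬separatedᵢ))

crossing-edge : (L : Labelling G m) {i : Fin m} → ∀ {x y} → Walk G k x y → label L x i ≢ label L y i →
                ∃[ a ] ∃[ b ] (Graph._∼_ G a b × label L a i ≢ label L b i)
crossing-edge L (nil x≈y) x≢y = contradiction (label-cong L x≈y _) x≢y
crossing-edge L {i} {x} (cons {y = z} x∼z w) x≢y with label L x i Bool.≟ label L z i
... | no  x≢z = x , z , x∼z , x≢z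
... | yes x≡z = crossing-edge L w (x≢y ∘ trans x≡z)

-- Halfspaces and the comparison of two labellings

≢-≢⇒≡ : ∀ {a b c : Bool} → a ≢ c → b ≢ c → a ≡ b
≢-≢⇒≡ a≢c b≢c = trans (¬-not a≢c) (sym (¬-not b≢c))

-- The halfspace of a coordinate consists of the vertices closer to c than to
-- d, for an edge cd across the coordinate, so it does not depend on the
-- labelling.
same-halfspace : (L : Labelling G l) (L′ : Labelling G m) {i : Fin l} {j : Fin m} → ∀ {c d v} →
                 Graph._∼_ G c d → label L c i ≢ label L d i → label L′ c j ≢ label L′ d j →
                 label L v i ≡ label L c i → label L′ v j ≡ label L′ c j
same-halfspace {G} L L′ {i} {j} {c} {d} {v} c∼d c≢d c≢′d v≡c
  with label L′ v j Bool.≟ label L′ c j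
... | yes v≡′c = v≡′c
-- Were `v` on the side of `d` under `L′`, the labellings would disagree about which of `c` and `d`
-- is nearer, and the distance from `v` to `c` would exceed itself by two.
... | no  v≢′c = contradiction (begin
    h L′ v c             ≡⟨ ham-step (label L′ v) (label L′ d) (label L′ c)
                              (∼⇒h≡1 L′ (Graph.∼-sym G c∼d)) (c≢′d ∘ sym) (≢-≢⇒≡ v≢′c (c≢′d ∘ sym)) ⟩
    suc (h L′ v d)       ≡⟨ cong suc (distance-unique G (distance L′ v d) (distance L v d)) ⟩
    suc (h L v d)        ≡⟨ cong suc (ham-step (label L v) (label L c) (label L d) (∼⇒h≡1 L c∼d) c≢d v≡c) ⟩
    suc (suc (h L v c))  ≡⟨ cong (2 +_) (distance-unique G (distance L v c) (distance L′ v c)) ⟩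
    suc (suc (h L′ v c)) ∎) (m≢1+n+m (h L′ v c) {1})
  where open ≡-Reasoning

-- Suppose that the edges chosen for `i` and `i′` flip the same bit of `L′`. Then the ends of the
-- first lie in different halfspaces of the second, so the first flips `i′` under `L` as well, and
-- an edge flips only one bit. Both minimality claims come from this injection.
tight-injection : (L : Labelling G l) → Tight L → Labelling G m → Fin l ↣ Fin m
tight-injection {G} {l} L tight L′ = mk↣ {to = coordinate} coordinate-injective
  where
  edge : (i : Fin l) → ∃[ a ] ∃[ b ] (Graph._∼_ G a b × label L a i ≢ label L b i)
  edge i = let x , y , x≢y = tight i in crossing-edge L (proj₁ (distance L x y)) x≢y

  changed : (i : Fin l) → let a , b , _ = edge i in ∃[ j ] label L′ a j ≢ label L′ b j
  changed i = let a , b , a∼b , _ = edge i in ham-differ (label L′ a) (label L′ b) (∼⇒h≡1 L′ a∼b)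

  coordinate = proj₁ ∘ changed

  coordinate-injective : ∀ {i i′} → coordinate i ≡ coordinate i′ → i ≡ i′
  coordinate-injective {i} {i′} same = ham≡1⇒unique (label L a) (label L b) (∼⇒h≡1 L a∼b) a≢b a≢b-at-i′
    where
    a = proj₁ (edge i)
    b = proj₁ (proj₂ (edge i))
    a∼b = proj₁ (proj₂ (proj₂ (edge i)))
    a≢b = proj₂ (proj₂ (proj₂ (edge i)))
    c = proj₁ (edge i′)
    d = proj₁ (proj₂ (edge i′))
    c∼d = proj₁ (proj₂ (proj₂ (edge i′)))
    c≢d = proj₂ (proj₂ (proj₂ (edge i′)))
    j = coordinate i′
    c≢′d : label L′ c j ≢ label L′ d j
    c≢′d = proj₂ (changed i′)
    a≢′b : label L′ a j ≢ label L′ b j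
    a≢′b = subst (λ j → label L′ a j ≢ label L′ b j) same (proj₂ (changed i))
    -- The labellings exchange roles: the halfspaces of bit `j` of `L′` are carried over to bit `i′`
    -- of `L`.
    c-side : ∀ {v} → label L′ v j ≡ label L′ c j → label L v i′ ≡ label L c i′
    c-side = same-halfspace L′ L c∼d c≢′d c≢d
    d-side : ∀ {v} → label L′ v j ≡ label L′ d j → label L v i′ ≡ label L d i′
    d-side = same-halfspace L′ L (Graph.∼-sym G c∼d) (c≢′d ∘ sym) (c≢d ∘ sym)
    a≢b-at-i′ : label L a i′ ≢ label L b i′
    -- Whichever end of the second edge `a` sides with, `b` sides with the other, so equal bits of
    -- `a` and `b` at `i′` would equate those of `c` and `d`.
    a≢b-at-i′ a≡b with label L′ a j Bool.≟ label L′ c j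
    ... | yes a≡′c = c≢d (trans (sym (c-side a≡′c))
                       (trans a≡b (d-side (≢-≢⇒≡ (λ b≡′c → a≢′b (trans a≡′c (sym b≡′c))) (c≢′d ∘ sym)))))
    ... | no  a≢′c = c≢d (trans (sym (c-side (≢-≢⇒≡ (a≢′b ∘ sym) (a≢′c ∘ sym))))
                       (trans (sym a≡b) (d-side (≢-≢⇒≡ a≢′c (c≢′d ∘ sym)))))

-- Expansions

transport : G ≅ H → Labelling G m → Labelling H m
transport {G} {H} iso L = mkLabelling (label L ∘ from)
  (λ x≈y → label-cong L (from-cong x≈y))
  (λ {x} {y} x∼y → ≤-reflexive (∼⇒h≡1 L (Equivalence.from (edges (from x) (from y))
    (proj₁ H.∼-resp-≈ (HV.sym (strictlyInverseˡ y)) (proj₂ H.∼-resp-≈ (HV.sym (strictlyInverseˡ x)) x∼y)))))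
  (λ x y → walk-respˡ H (HV.sym (strictlyInverseˡ x)) (walk-respʳ H (strictlyInverseˡ y)
    (map-walk (proj₁ (distance L (from x) (from y))))))
  where
  open _≅_ iso
  open Inverse vertices
  module H = Graph H
  module HV = Setoid (V H)
  map-walk : ∀ {k x y} → Walk G k x y → Walk H k (to x) (to y)
  map-walk (nil x≈y)    = nil (to-cong x≈y)
  map-walk (cons x∼z w) = cons (Equivalence.to (edges _ _) x∼z) (map-walk w)

module _ {G₁ G₂ : Subgraph G} (isometric₁ : Isometric G₁) (isometric₂ : Isometric G₂)
         (union : G ≡ G₁ ∪ G₂) (L : Labelling G m) where
  open Subgraph
  private
    module G = Setoid (V G)
    G′ = expansion G₁ G₂

    φ : Vertex G′ → Vector Bool (suc m)
    φ (inj₁ (x , _)) = false ∷ label L x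
    φ (inj₂ (x , _)) = true  ∷ label L x

    φ-cong : ∀ {u v} → Graph._≈_ G′ u v → φ u ≗ φ v
    φ-cong (inj₁ x≈y) zero    = refl
    φ-cong (inj₁ x≈y) (suc i) = label-cong L x≈y i
    φ-cong (inj₂ x≈y) zero    = refl
    φ-cong (inj₂ x≈y) (suc i) = label-cong L x≈y i

    edge : ∀ u v → Graph._∼_ G′ u v → ham (φ u) (φ v) ≤ 1
    edge (inj₁ _) (inj₁ _) x∼y = ≤-reflexive (∼⇒h≡1 L (Eₛ⊆∼ G₁ x∼y))
    edge (inj₁ _) (inj₂ _) x≈y = s≤s (≤-reflexive (≗⇒ham≡0 (label-cong L x≈y)))
    edge (inj₂ _) (inj₁ _) x≈y = s≤s (≤-reflexive (≗⇒ham≡0 (label-cong L x≈y)))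
    edge (inj₂ _) (inj₂ _) x∼y = ≤-reflexive (∼⇒h≡1 L (Eₛ⊆∼ G₂ x∼y))

    lift₁ : ∀ {k u v} → Walk (graph G₁) k u v → Walk G′ k (inj₁ u) (inj₁ v)
    lift₁ (nil x≈y)    = nil (inj₁ x≈y)
    lift₁ (cons {y = z} x∼z w) = cons {y = inj₁ z} x∼z (lift₁ w)

    lift₂ : ∀ {k u v} → Walk (graph G₂) k u v → Walk G′ k (inj₂ u) (inj₂ v)
    lift₂ (nil x≈y)    = nil (inj₂ x≈y)
    lift₂ (cons {y = z} x∼z w) = cons {y = inj₂ z} x∼z (lift₂ w)

    -- Isometry of `G₁` realises the distance in `G` by a walk inside `G₁`, which then lifts to the
    -- first copy.
    walk₁ : ∀ u v → Walk G′ (h L (proj₁ u) (proj₁ v)) (inj₁ u) (inj₁ v)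
    walk₁ u v = lift₁ (proj₁ (Equivalence.from (isometric₁ u v _) (distance L (proj₁ u) (proj₁ v))))

    walk₂ : ∀ u v → Walk G′ (h L (proj₁ u) (proj₁ v)) (inj₂ u) (inj₂ v)
    walk₂ u v = lift₂ (proj₁ (Equivalence.from (isometric₂ u v _) (distance L (proj₁ u) (proj₁ v))))

    -- A geodesic from V₁ to V₂ changes copies just before its first edge
    -- outside E₁; the isometry of G₂ provides the rest.
    walk₁₂ : ∀ {k x y} (x∈V₁ : Vₛ G₁ x) (y∈V₂ : Vₛ G₂ y) → Walk G k x y → k ≡ h L x y →
             Walk G′ (suc k) (inj₁ (x , x∈V₁)) (inj₂ (y , y∈V₂))
    walk₁₂ {y = y} x∈V₁ y∈V₂ (nil x≈y) _ = cons {y = inj₂ (y , y∈V₂)} x≈y (nil (inj₂ G.refl))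
    walk₁₂ {x = x} {y} x∈V₁ y∈V₂ (cons {y = z} x∼z w) k≡h with proj₂ union x z x∼z
    ... | inj₁ xz∈E₁ =
      let z∈V₁ = proj₂ (Eₛ⊆Vₛ G₁ xz∈E₁)
      in cons {y = inj₁ (z , z∈V₁)} xz∈E₁ (walk₁₂ z∈V₁ y∈V₂ w (geodesic-tail L x∼z w k≡h))
    ... | inj₂ xz∈E₂ =
      let x∈V₂ = proj₁ (Eₛ⊆Vₛ G₂ xz∈E₂)
      in cons {y = inj₂ (x , x∈V₂)} G.refl
           (subst (λ k → Walk G′ k (inj₂ (x , x∈V₂)) (inj₂ (y , y∈V₂))) (sym k≡h)
             (walk₂ (x , x∈V₂) (y , y∈V₂)))

    walk : ∀ u v → Walk G′ (ham (φ u) (φ v)) u v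
    walk (inj₁ u) (inj₁ v) = walk₁ u v
    walk (inj₂ u) (inj₂ v) = walk₂ u v
    walk (inj₁ (x , p)) (inj₂ (y , q)) = walk₁₂ p q (proj₁ (distance L x y)) refl
    walk (inj₂ (y , q)) (inj₁ (x , p)) = walk-sym G′
      (subst (λ k → Walk G′ (suc k) (inj₁ (x , p)) (inj₂ (y , q))) (ham-sym (label L x) (label L y))
        (walk₁₂ p q (proj₁ (distance L x y)) refl))

  expansion-labelling : Labelling G′ (suc m)
  expansion-labelling = mkLabelling φ φ-cong (λ {u} {v} → edge u v) walk

expansions⇒labelling : ExpansionSequence K₁ n G → Labelling G n
expansions⇒labelling (done iso) = transport iso (mkLabelling (λ _ ()) (λ _ ()) (λ ()) (λ _ _ → nil refl))
expansions⇒labelling (expand seq G′-expansion) =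
  transport result (expansion-labelling isometric₁ isometric₂ union (expansions⇒labelling seq))
  where open _IsExpansionOf_ G′-expansion

-- Contractions

-- Contracting the edges across coordinate zero identifies the vertices whose
-- labels agree elsewhere.
module Contraction (L : Labelling G (suc m)) where
  open Graph G using (_≈_; _∼_)
  private module V = Setoid (V G)

  head : Vertex G → Bool
  head x = label L x zero

  tail : Vertex G → Vector Bool m
  tail x = label L x ∘ suc

  h-tail : Vertex G → Vertex G → ℕ
  h-tail x y = ham (tail x) (tail y)

  same-side : ∀ x y → head x ≡ head y → h L x y ≡ h-tail x y
  same-side _ _ eq = cong₂ _+_ (bit-≡ eq) refl

  other-side : ∀ x y → head x ≢ head y → h L x y ≡ suc (h-tail x y)
  other-side _ _ ≢ = cong₂ _+_ (bit-≢ ≢) refl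

  flip-edge : ∀ {x y} → x ∼ y → head x ≢ head y → tail x ≗ tail y
  flip-edge {x} {y} x∼y x≢y = ham≡0⇒≗ (tail x) (tail y)
    (suc-injective (trans (sym (other-side x y x≢y)) (∼⇒h≡1 L x∼y)))

  -- The quotient keeps the vertices of `G` and coarsens their equality to that of tails. Adjacency
  -- as distance one of tails is independent of representatives.
  contraction : Graph
  contraction = record
    { V        = On.setoid (Fin m →-setoid Bool) tail
    ; _∼_      = λ x y → h-tail x y ≡ 1
    ; ∼-resp-≈ = (λ {x} y≈z → trans (ham-cong {P = tail x} (λ _ → refl) (sym ∘ y≈z)))
               , (λ {x} y≈z → trans (ham-cong {Q = tail x} (sym ∘ y≈z) λ _ → refl))
    ; ∼-sym    = λ {x} {y} → trans (ham-sym (tail y) (tail x))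
    ; ∼-irrefl = λ x≈y h≡1 → contradiction (trans (sym (≗⇒ham≡0 x≈y)) h≡1) λ ()
    ; nonempty = Graph.nonempty G
    }

  -- Along a geodesic, an edge across bit zero becomes an equality and every other edge stays an
  -- edge, so only the changes of the tail are counted.
  contract-walk : ∀ {x y} → Walk G k x y → k ≡ h L x y → Walk contraction (h-tail x y) x y
  contract-walk {x = x} {y} (nil x≈y) _ =
    subst (λ k → Walk contraction k x y) (sym (≗⇒ham≡0 (label-cong L x≈y ∘ suc))) (nil (label-cong L x≈y ∘ suc))
  contract-walk {suc k} {x} {y} (cons {y = z} x∼z w) 1+k≡h
    with k≡h ← geodesic-tail L x∼z w 1+k≡h | head x Bool.≟ head z
  ... | no  x≢z = walk-respˡ contraction x≈z
        (subst (λ k → Walk contraction k z y)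
          (ham-cong {Q = tail y} (sym ∘ x≈z) λ _ → refl) (contract-walk w k≡h))
    where
    x≈z = flip-edge x∼z x≢z
  ... | yes x≡z = subst (λ k → Walk contraction k x y) (sym h-tail≡)
        (cons (trans (sym (same-side x z x≡z)) (∼⇒h≡1 L x∼z)) (contract-walk w k≡h))
    where
    open ≡-Reasoning
    h-tail≡ : h-tail x y ≡ suc (h-tail z y)
    -- The first edge leaves bit zero alone, so the heads contribute equally on both sides and
    -- cancel.
    h-tail≡ = +-cancelˡ-≡ (bit (head x xor head y)) _ _ (begin
      h L x y                                          ≡⟨ 1+k≡h ⟨
      suc k                                            ≡⟨ cong suc k≡h ⟩
      suc (bit (head z xor head y) + h-tail z y)       ≡⟨ +-suc (bit (head z xor head y)) _ ⟨
      bit (head z xor head y) + suc (h-tail z y)       ≡⟨ cong (λ b → bit (b xor head y) + suc (h-tail z y)) x≡z ⟨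
      bit (head x xor head y) + suc (h-tail z y)       ∎)

  contraction-labelling : Labelling contraction m
  contraction-labelling = mkLabelling tail id ≤-reflexive λ x y → contract-walk (proj₁ (distance L x y)) refl

  -- A vertex stands for its class here, so some representative has head `β`, not necessarily `x`. A
  -- class with representatives of both kinds lies in both subgraphs.
  Side : Bool → Vertex G → Set
  Side β x = ∃[ y ] (head y ≡ β × tail y ≗ tail x)

  own-side : ∀ {x β} → head x ≡ β → Side β x
  own-side {x} x≡β = x , x≡β , λ _ → refl

  side : (β : Bool) → ∃ (Side β) → Subgraph contraction
  side β inhabited = record
    { Vₛ        = Side β
    ; Eₛ        = λ x y → Side β x × Side β y × h-tail x y ≡ 1
    ; Vₛ-resp   = resp
    ; Eₛ-resp   = (λ {x} y≈z (p , q , x∼y) → p , resp y≈z q , proj₁ (Graph.∼-resp-≈ contraction) {x} y≈z x∼y)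
                , (λ {x} y≈z (q , p , y∼x) → resp y≈z q , p , proj₂ (Graph.∼-resp-≈ contraction) {x} y≈z y∼x)
    ; Eₛ-sym    = λ {x} {y} (p , q , x∼y) → q , p , Graph.∼-sym contraction {x} {y} x∼y
    ; Eₛ⊆Vₛ     = λ (p , q , _) → p , q
    ; Eₛ⊆∼      = λ (_ , _ , x∼y) → x∼y
    ; nonemptyₛ = inhabited
    }
    where
    resp : ∀ {x y} → tail x ≗ tail y → Side β x → Side β y
    resp x≈y (z , z≡β , z≈x) = z , z≡β , λ i → trans (z≈x i) (x≈y i)

  module _ (β : Bool) (inhabited : ∃ (Side β)) where
    private S = Subgraph.graph (side β inhabited)

    -- A geodesic between vertices that agree in bit zero never flips that bit, so it stays on its
    -- side.
    side-walk : ∀ {x y} → Walk G k x y → k ≡ h L x y → (x≡β : head x ≡ β) (y≡β : head y ≡ β) →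
                Walk S k (x , own-side x≡β) (y , own-side y≡β)
    side-walk (nil x≈y) _ _ _ = nil (label-cong L x≈y ∘ suc)
    side-walk {suc k} {x} {y} (cons {y = z} x∼z w) 1+k≡h x≡β y≡β
      with k≡h ← geodesic-tail L x∼z w 1+k≡h | head x Bool.≟ head z
    ... | yes x≡z = cons
          (own-side x≡β , own-side z≡β , trans (sym (same-side x z x≡z)) (∼⇒h≡1 L x∼z))
          (side-walk w k≡h z≡β y≡β)
      where
      z≡β = trans (sym x≡z) x≡β
    -- An edge across bit zero would have to be undone later, so the remaining `k` steps would have
    -- to cover a distance of `k` plus two.
    ... | no  x≢z = contradiction (begin
          k                 ≡⟨ k≡h ⟩
          h L z y           ≡⟨ other-side z y (λ z≡y → x≢z (trans x≡y (sym z≡y))) ⟩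
          suc (h-tail z y)  ≡⟨ cong suc (ham-cong {Q = tail y} (flip-edge x∼z x≢z) λ _ → refl) ⟨
          suc (h-tail x y)  ≡⟨ cong suc (same-side x y x≡y) ⟨
          suc (h L x y)     ≡⟨ cong suc 1+k≡h ⟨
          suc (suc k)       ∎) λ ()
      where
      open ≡-Reasoning
      x≡y = trans x≡β (sym y≡β)

    side-labelling : Labelling S m
    side-labelling = mkLabelling (tail ∘ proj₁) id (λ (_ , _ , x∼y) → ≤-reflexive x∼y) walk
      where
      walk : ∀ u v → Walk S (h-tail (proj₁ u) (proj₁ v)) u v
      walk u@(x , x′ , x′≡β , x′≈x) v@(y , y′ , y′≡β , y′≈y) =
        -- Both classes are replaced by their representatives on side `β`, which are joined by a
        -- geodesic of `G`.
        subst (λ k → Walk S k u v) (trans (same-side x′ y′ (trans x′≡β (sym y′≡β))) (ham-cong x′≈x y′≈y))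
          (walk-respˡ S (sym ∘ x′≈x) (walk-respʳ S y′≈y
            (side-walk (proj₁ (distance L x′ y′)) refl x′≡β y′≡β)))

    side-isometric : Isometric (side β inhabited)
    side-isometric = preserves-distance side-labelling contraction-labelling proj₁ λ _ _ → refl

  -- For adjacent classes with representatives x and y on opposite sides, the
  -- middle vertex of a geodesic from x to y represents one of the classes on
  -- the other side.
  edge-side : ∀ x y → h-tail x y ≡ 1 → ∃[ β ] (Side β x × Side β y)
  edge-side x y h≡1 with head x Bool.≟ head y
  ... | yes x≡y = head x , own-side refl , own-side (sym x≡y)
  ... | no  x≢y
    with cons {y = z} x∼z (cons z∼w (nil w≈y)) ←
      subst (λ k → Walk G k x y) (trans (other-side x y x≢y) (cong suc h≡1)) (proj₁ (distance L x y))
    with head x Bool.≟ head z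
  ...   | yes x≡z = head x , own-side refl ,
            (z , sym x≡z , flip-edge (proj₁ (Graph.∼-resp-≈ G) w≈y z∼w) (x≢y ∘ trans x≡z))
  ...   | no  x≢z = head y ,
            (z , ≢-≢⇒≡ (x≢z ∘ sym) (x≢y ∘ sym) , sym ∘ flip-edge x∼z x≢z) , own-side refl

  module _ (inhabited : ∀ β → ∃ (Side β)) where

    G₁ G₂ : Subgraph contraction
    G₁ = side false (inhabited false)
    G₂ = side true  (inhabited true)

    some-side : (A : Bool → Set) → ∃ A → A false ⊎ A true
    some-side _ (false , a) = inj₁ a
    some-side _ (true  , a) = inj₂ a

    G′ : Graph
    G′ = expansion G₁ G₂

    copy : ∀ β → ∃ (Side β) → Vertex G′
    copy false = inj₁
    copy true  = inj₂

    copy-cong : ∀ {β β′} (u : ∃ (Side β)) (v : ∃ (Side β′)) → β ≡ β′ → tail (proj₁ u) ≗ tail (proj₁ v) →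
                Graph._≈_ G′ (copy β u) (copy β′ v)
    copy-cong {false} _ _ refl u≈v = inj₁ u≈v
    copy-cong {true}  _ _ refl u≈v = inj₂ u≈v

    -- A copy of a class goes to the representative stored in the proof of `Side`; head and tail
    -- determine that vertex up to `≈`.
    to : Vertex G′ → Vertex G
    to (inj₁ (_ , x , _)) = x
    to (inj₂ (_ , x , _)) = x

    from : Vertex G → Vertex G′
    from x = copy (head x) (x , own-side refl)

    to-from : ∀ x → to (from x) ≈ x
    -- `to (from x)` is stuck on `head x`, so this bit is generalised together with its equation.
    to-from x = go (head x) refl
      where
      go : ∀ β (x≡β : head x ≡ β) → to (copy β (x , own-side x≡β)) ≈ x
      go false _ = V.refl
      go true  _ = V.refl

    from-to : ∀ u → Graph._≈_ G′ (from (to u)) u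
    from-to (inj₁ u@(_ , x , x≡β , x≈)) = copy-cong {β′ = false} (x , own-side refl) u x≡β x≈
    from-to (inj₂ u@(_ , x , x≡β , x≈)) = copy-cong {β′ = true}  (x , own-side refl) u x≡β x≈

    representatives-≈ : ∀ {x x′ y y′ β} → head x ≡ β → tail x ≗ tail x′ → head y ≡ β → tail y ≗ tail y′ →
                        tail x′ ≗ tail y′ → x ≈ y
    representatives-≈ {x} {y = y} x≡β x≈ y≡β y≈ x′≈y′ = h≡0⇒≈ L
      (trans (same-side x y (trans x≡β (sym y≡β))) (≗⇒ham≡0 λ i → trans (x≈ i) (trans (x′≈y′ i) (sym (y≈ i)))))

    to-cong : ∀ {u v} → Graph._≈_ G′ u v → to u ≈ to v
    to-cong (inj₁ {_ , _ , x≡β , x≈} {_ , _ , y≡β , y≈} u≈v) = representatives-≈ x≡β x≈ y≡β y≈ u≈v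
    to-cong (inj₂ {_ , _ , x≡β , x≈} {_ , _ , y≡β , y≈} u≈v) = representatives-≈ x≡β x≈ y≡β y≈ u≈v

    from-cong : ∀ {x y} → x ≈ y → Graph._≈_ G′ (from x) (from y)
    from-cong {x} {y} x≈y = copy-cong (x , own-side refl) (y , own-side refl)
      (label-cong L x≈y zero) (label-cong L x≈y ∘ suc)

    same-side-edge : ∀ {x x′ y y′ β} → head x ≡ β → tail x ≗ tail x′ → head y ≡ β → tail y ≗ tail y′ →
                     h-tail x′ y′ ≡ 1 ⇔ x ∼ y
    same-side-edge {x} {x′} {y} {y′} x≡β x≈ y≡β y≈ = mk⇔
      (λ h≡1 → h≡1⇒∼ L (trans h≡ h≡1))
      (λ x∼y → trans (sym h≡) (∼⇒h≡1 L x∼y))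
      where
      h≡ : h L x y ≡ h-tail x′ y′
      h≡ = trans (same-side x y (trans x≡β (sym y≡β))) (ham-cong x≈ y≈)

    -- Once bit zero differs, distance one leaves no difference for the tails. These are the edges
    -- between the two copies.
    other-side-edge : ∀ {x x′ y y′} → head x ≢ head y → tail x ≗ tail x′ → tail y ≗ tail y′ →
                      (tail x′ ≗ tail y′) ⇔ x ∼ y
    other-side-edge {x} {x′} {y} {y′} x≢y x≈ y≈ = mk⇔
      (λ x′≈y′ → h≡1⇒∼ L (trans h≡ (cong suc (≗⇒ham≡0 x′≈y′))))
      (λ x∼y → ham≡0⇒≗ (tail x′) (tail y′) (suc-injective (trans (sym h≡) (∼⇒h≡1 L x∼y))))
      where
      h≡ : h L x y ≡ suc (h-tail x′ y′)
      h≡ = trans (other-side x y x≢y) (cong suc (ham-cong x≈ y≈))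

    separate : ∀ {x y β} → head x ≡ β → head y ≡ not β → head x ≢ head y
    separate x≡β y≡¬β x≡y = not-¬ refl (trans (sym x≡β) (trans x≡y y≡¬β))

    edges : ∀ u v → Graph._∼_ G′ u v ⇔ to u ∼ to v
    edges (inj₁ (x′ , p@(x , x≡ , x≈))) (inj₁ (y′ , q@(y , y≡ , y≈))) =
      let e = same-side-edge x≡ x≈ y≡ y≈
      in mk⇔ (λ (_ , _ , xy) → Equivalence.to e xy) (λ xy → p , q , Equivalence.from e xy)
    edges (inj₂ (x′ , p@(x , x≡ , x≈))) (inj₂ (y′ , q@(y , y≡ , y≈))) =
      let e = same-side-edge x≡ x≈ y≡ y≈
      in mk⇔ (λ (_ , _ , xy) → Equivalence.to e xy) (λ xy → p , q , Equivalence.from e xy)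
    edges (inj₁ (_ , x , x≡ , x≈)) (inj₂ (_ , y , y≡ , y≈)) = other-side-edge (separate x≡ y≡) x≈ y≈
    edges (inj₂ (_ , x , x≡ , x≈)) (inj₁ (_ , y , y≡ , y≈)) = other-side-edge (separate x≡ y≡) x≈ y≈

    is-expansion : G IsExpansionOf contraction
    is-expansion = record
      { connected  = connected contraction-labelling
      ; G₁         = G₁
      ; G₂         = G₂
      ; isometric₁ = side-isometric false (inhabited false)
      ; isometric₂ = side-isometric true (inhabited true)
      ; union      = (λ x → some-side (λ β → Side β x) (head x , own-side refl))
                   , (λ x y x∼y → let β , p , q = edge-side x y x∼y in
                       some-side (λ β → Side β x × Side β y × h-tail x y ≡ 1) (β , p , q , x∼y))
      ; result     = record
          { vertices = record
              { to        = to
              ; from      = from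
              ; to-cong   = to-cong
              ; from-cong = from-cong
              ; inverse   = (λ {x} u≈ → V.trans (to-cong u≈) (to-from x))
                          , (λ {u} x≈ → Setoid.trans (V′ G′) (from-cong x≈) (from-to u))
              }
          ; edges    = edges
          }
      }
      where V′ = Graph.V

-- Contraction keeps all vertices and the other bits, so tightness is inherited, while tightness of
-- bit zero makes both sides nonempty. Without bits all distances are zero and `G` is a single
-- vertex.
tight⇒expansions : (L : Labelling G m) → Tight L → ExpansionSequence K₁ m G
tight⇒expansions {G} {zero} L _ = done record
  { vertices = record
      { to        = λ _ → Graph.nonempty G
      ; from      = λ _ → tt
      ; to-cong   = λ _ → h≡0⇒≈ L refl
      ; from-cong = λ _ → refl
      ; inverse   = (λ _ → h≡0⇒≈ L refl) , (λ _ → refl)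
      }
  ; edges = λ _ _ → mk⇔ (λ ()) (λ e → contradiction e (Graph.∼-irrefl G (h≡0⇒≈ L refl)))
  }
tight⇒expansions {G} {suc m} L tight =
  expand (tight⇒expansions contraction-labelling (tight ∘ suc)) (is-expansion inhabited)
  where
  open Contraction L
  inhabited : ∀ β → ∃ (Side β)
  inhabited β with x , y , x≢y ← tight zero | head x Bool.≟ β
  ... | yes x≡β = x , own-side x≡β
  ... | no  x≢β = y , own-side (≢-≢⇒≡ (x≢y ∘ sym) (x≢β ∘ sym))

-- The characterisation of partial cubes and their dimension

corollary8p2 : (∀ (G : Graph) → Finite G → Connected G →
    PartialCube G ⇔ (∃[ n ] ExpansionSequence K₁ n G)) ×
    (∀ (G : Graph) → Finite G → PartialCube G →
    ∃[ d ] (IsometricDimension G d × ExpansionNumber G d))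
corollary8p2 =
  (λ G G-finite _ → mk⇔
    (λ cube → let d , _ , expansions , _ = dimension G G-finite cube in d , expansions)
    (λ (n , expansions) → Fin n , labelling⇒embedding (expansions⇒labelling expansions))) ,
  dimension
  where
  dimension : ∀ G → Finite G → PartialCube G → ∃[ d ] (IsometricDimension G d × ExpansionNumber G d)
  dimension G G-finite (_ , embedding) =
    let _ , L₀ , _    = embedding⇒labelling G-finite embedding
        d , L , tight = tighten G-finite L₀
    in d ,
       (labelling⇒embedding L ,
        -- The tight bits inject into the finitely many coordinates extracted from the other
        -- embedding, and these inject into `X`.
        λ X embedding′ → let _ , L′ , ι = embedding⇒labelling G-finite embedding′
                         in ι ↣-∘ tight-injection L tight L′) ,
       (tight⇒expansions L tight ,
        -- A sequence of expansions gives a labelling with as many bits as it has steps, and the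
        -- tight bits inject into them.
        λ _ expansions → injective⇒≤ (Injection.injective
          (tight-injection L tight (expansions⇒labelling expansions))))
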